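{- Let $n\ge 3$ be an odd integer and $k\ge 3$ an integer. Then $\psi(C_n\square P_k)=3$, i.e. the minimum size of a doubly resolving set of the cartesian product $C_n\square P_k$ is $3$.
   Context: All graphs are finite and connected; $d(u,v)$ is the shortest-path distance. $C_n$ is the cycle on $n$ vertices and $P_k$ the path on $k$ vertices. The cartesian product $G\square H$ has vertex set $V(G)\times V(H)$, with $(g_1,h_1)$ adjacent to $(g_2,h_2)$ iff either $h_1=h_2$ and $g_1g_2\in E(G)$, or $g_1=g_2$ and $h_1h_2\in E(H)$. For an ordered set $Q=\{q_1,\dots,q_l\}$ of vertices, $r(x|Q)=(d(x,q_1),\dots,d(x,q_l))$. $Q$ is a doubly resolving set of $G$ if for any two distinct vertices $x,y$ of $G$, $r(x|Q)-r(y|Q)\neq\lambda(1,\dots,1)$ for every integer $\lambda$. $\psi(G)$ denotes the minimum size of a doubly resolving set of $G$. -}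

module Defs where

open import Data.Fin.Base using (Fin; zero; suc; toℕ; inject₁)
open import Data.Fin.Induction using (<-weakInduction)
import Data.Fin.Properties as Fin
open import Data.Integer.Base using (ℤ; +_; _-_; _*_; 1ℤ)
open import Data.Nat.Base using (ℕ; zero; suc; _≤_; z≤n; s≤s) renaming (_*_ to _ℕ*_)
import Data.Nat.Properties as ℕ
open import Data.Product.Base using (Σ; ∃; _×_; _,_; proj₁; proj₂)
open import Data.Product.Function.NonDependent.Propositional using (_×-↔_)
open import Data.Sum.Base using (_⊎_; inj₁; inj₂; swap)
open import Data.Vec.Base using (Vec; map; replicate; zipWith)
open import Data.Vec.Relation.Unary.Unique.Propositional using (Unique)
open import Function.Base using (_∘_)
open import Function.Bundles using (_↔_; module Inverse)
open import Function.Construct.Composition using (_↔-∘_)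
open import Function.Construct.Identity using (↔-id)
open import Function.Construct.Symmetry using (↔-sym)
open import Function.Properties.Inverse using (↔⇒↣)
open import Level using (0ℓ)
open import Relation.Binary.Construct.Closure.ReflexiveTransitive
  using (Star; ε; _◅_; _◅◅_; fold; gmap; reverse)
open import Relation.Binary.Core using (Rel)
open import Relation.Binary.Definitions
  using (Symmetric; Irreflexive; DecidableEquality) renaming (Decidable to Decidable₂)
open import Relation.Binary.PropositionalEquality
  using (_≡_; _≢_; refl; sym; trans; cong; subst)
open import Relation.Nullary.Decidable using (Dec; yes; no; map′; via-injection; _×-dec_; _⊎-dec_)
open import Relation.Nullary.Negation using (¬_; contradiction)
open import Relation.Unary using (Pred; Decidable)

IsLeast : Pred ℕ 0ℓ → Pred ℕ 0ℓ
IsLeast P m = P m × (∀ n → P n → m ≤ n)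

least : ∀ {P : Pred ℕ 0ℓ} → Decidable P → ∀ n → P n → ∃ (IsLeast P)
least P? zero    p = zero , p , λ _ _ → z≤n
least P? (suc n) p with P? zero
... | yes p₀ = zero , p₀ , λ _ _ → z≤n
... | no ¬p₀ with least (P? ∘ suc) n p
...   | m , pm , min = suc m , pm , λ where
          zero    p₀ → contradiction p₀ ¬p₀
          (suc j) pj → s≤s (min j pj)

record Graph : Set₁ where
  infix 4 _~_ _~?_
  field
    V         : Set
    _~_       : Rel V 0ℓ
    ~-sym     : Symmetric _~_
    ~-irrefl  : Irreflexive _≡_ _~_
    _~?_      : Decidable₂ _~_
    order     : ℕ
    finite    : V ↔ Fin order
    connected : ∀ u v → Star _~_ u v

  infix 4 _≟_
  _≟_ : DecidableEquality V
  _≟_ = via-injection (↔⇒↣ finite) Fin._≟_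

  any? : ∀ {P : Pred V 0ℓ} → Decidable P → Dec (∃ P)
  any? {P} P? = map′
    (λ (i , p) → from i , p)
    (λ (v , p) → to v , subst P (sym (strictlyInverseʳ v)) p)
    (Fin.any? (P? ∘ from))
    where open Inverse finite

  length : ∀ {u v} → Star _~_ u v → ℕ
  length = fold (λ _ _ → ℕ) (λ _ n → suc n) 0

  WalkOfLength : V → V → Pred ℕ 0ℓ
  WalkOfLength u v n = Σ (Star _~_ u v) λ w → length w ≡ n

  walkOfLength? : ∀ u v → Decidable (WalkOfLength u v)
  walkOfLength? u v zero = map′
    (λ { refl → ε , refl })
    (λ { (ε , refl) → refl })
    (u ≟ v)
  walkOfLength? u v (suc n) = map′
    (λ { (_ , e , w , refl) → e ◅ w , refl })
    (λ { (e ◅ w , refl) → _ , e , w , refl })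
    (any? λ x → (u ~? x) ×-dec walkOfLength? x v n)

  shortest : ∀ u v → ∃ (IsLeast (WalkOfLength u v))
  shortest u v = least (walkOfLength? u v) (length (connected u v)) (connected u v , refl)

  d : V → V → ℕ
  d u v = proj₁ (shortest u v)

  d-isLeast : ∀ u v → IsLeast (WalkOfLength u v) (d u v)
  d-isLeast u v = proj₂ (shortest u v)

  r : ∀ {l} → V → Vec V l → Vec ℤ l
  r x Q = map (λ q → + d x q) Q

  DoublyResolving : ∀ {l} → Vec V l → Set
  DoublyResolving {l} Q = ∀ x y → x ≢ y → ∀ (c : ℤ) →
    zipWith _-_ (r x Q) (r y Q) ≢ map (c *_) (replicate l 1ℤ)

-- ψ as a relation: ψ[ G ]≡ m says that the minimum defining ψ(G) is attained
-- and equals m. An ordered set of size l is a vector of l distinct vertices.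
ψ[_]≡_ : Graph → ℕ → Set
ψ[ G ]≡ m = IsLeast (λ l → Σ (Vec V l) λ Q → Unique Q × DoublyResolving Q) m
  where open Graph G

Succ : ∀ {n} → Rel (Fin n) 0ℓ
Succ i j = suc (toℕ i) ≡ toℕ j

-- The successor relation of ℤ/n on representatives 0, …, n - 1.
CyclicSucc : ∀ {n} → Rel (Fin n) 0ℓ
CyclicSucc {n} i j = Succ i j ⊎ (suc (toℕ i) ≡ n × toℕ j ≡ 0)

PathAdj CycleAdj : ∀ {n} → Rel (Fin n) 0ℓ
PathAdj  i j = Succ i j ⊎ Succ j i
CycleAdj i j = CyclicSucc i j ⊎ CyclicSucc j i

path-connected : ∀ {n} (i j : Fin n) → Star PathAdj i j
path-connected {suc n} i j = reverse swap (from-zero i) ◅◅ from-zero j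
  where
  from-zero : ∀ i → Star (PathAdj {suc n}) zero i
  from-zero = <-weakInduction (Star PathAdj zero) ε
    λ i w → w ◅◅ (inj₁ (cong suc (Fin.toℕ-inject₁ i)) ◅ ε)

P : ℕ → Graph
P k = record
  { V         = Fin k
  ; _~_       = PathAdj
  ; ~-sym     = swap
  ; ~-irrefl  = λ { refl (inj₁ e) → ℕ.1+n≢n e ; refl (inj₂ e) → ℕ.1+n≢n e }
  ; _~?_      = λ i j → (suc (toℕ i) ℕ.≟ toℕ j) ⊎-dec (suc (toℕ j) ℕ.≟ toℕ i)
  ; order     = k
  ; finite    = ↔-id _
  ; connected = path-connected
  }

cyclicSucc-irrefl : ∀ {n} → 3 ≤ n → (i : Fin n) → ¬ CyclicSucc i i
cyclicSucc-irrefl _   i (inj₁ e) = ℕ.1+n≢n e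
cyclicSucc-irrefl 3≤n i (inj₂ (e , e₀)) =
  contradiction (subst (3 ≤_) (trans (sym e) (cong suc e₀)) 3≤n) λ { (s≤s ()) }

cyclicSucc? : ∀ {n} → Decidable₂ (CyclicSucc {n})
cyclicSucc? {n} i j =
  (suc (toℕ i) ℕ.≟ toℕ j) ⊎-dec ((suc (toℕ i) ℕ.≟ n) ×-dec (toℕ j ℕ.≟ 0))

C : (n : ℕ) → 3 ≤ n → Graph
C n 3≤n = record
  { V         = Fin n
  ; _~_       = CycleAdj
  ; ~-sym     = swap
  ; ~-irrefl  = λ { {i} refl (inj₁ s) → cyclicSucc-irrefl 3≤n i s
                  ; {i} refl (inj₂ s) → cyclicSucc-irrefl 3≤n i s }
  ; _~?_      = λ i j → cyclicSucc? i j ⊎-dec cyclicSucc? j i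
  ; order     = n
  ; finite    = ↔-id _
  ; connected = λ i j → gmap (λ v → v) path⇒cycle (path-connected i j)
  }
  where
  path⇒cycle : ∀ {i j : Fin n} → PathAdj i j → CycleAdj i j
  path⇒cycle (inj₁ s) = inj₁ (inj₁ s)
  path⇒cycle (inj₂ s) = inj₂ (inj₁ s)

infixr 7 _□_
_□_ : Graph → Graph → Graph
G □ H = record
  { V         = G.V × H.V
  ; _~_       = _~_
  ; ~-sym     = λ { (inj₁ (e , a)) → inj₁ (sym e , G.~-sym a)
                  ; (inj₂ (e , a)) → inj₂ (sym e , H.~-sym a) }
  ; ~-irrefl  = λ { refl (inj₁ (_ , a)) → G.~-irrefl refl a
                  ; refl (inj₂ (_ , a)) → H.~-irrefl refl a }
  ; _~?_      = λ (g₁ , h₁) (g₂ , h₂) →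
                  ((h₁ H.≟ h₂) ×-dec (g₁ G.~? g₂)) ⊎-dec ((g₁ G.≟ g₂) ×-dec (h₁ H.~? h₂))
  ; order     = G.order ℕ* H.order
  ; finite    = ↔-sym Fin.*↔× ↔-∘ (G.finite ×-↔ H.finite)
  ; connected = λ (g₁ , h₁) (g₂ , h₂) →
                  gmap (_, h₁) (λ a → inj₁ (refl , a)) (G.connected g₁ g₂)
                  ◅◅ gmap (g₂ ,_) (λ a → inj₂ (refl , a)) (H.connected h₁ h₂)
  }
  where
  module G = Graph G
  module H = Graph H
  _~_ : Rel (G.V × H.V) 0ℓ
  (g₁ , h₁) ~ (g₂ , h₂) = (h₁ ≡ h₂ × g₁ G.~ g₂) ⊎ (g₁ ≡ g₂ × h₁ H.~ h₂)

{-# OPTIONS --safe #-}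
-- Distances in G □ H add up.  If [a, b] doubly resolves G and [s, t] doubly
-- resolves H, then [(a, s), (b, s), (a, t)] doubly resolves G □ H: the first
-- two coordinates determine the component in G, the first and the last then
-- determine the component in H.  In C_(2m+1) the vertices 0 and m work, since
-- d(x,0) - d(x,m) is injective on each of the two arcs between them and has a
-- different parity on each; in P_k the two ends work.
-- Conversely no pair (a, s), (b, t) doubly resolves a nontrivial product: if a = b
-- or s = t, two vertices that differ only in that coordinate are not separated;
-- otherwise the two neighbours of (a, s) reached by a step towards (b, t) in one
-- factor or the other are not separated.
module Submission where

open import Defs
open import Data.Fin.Base using (Fin; zero; suc; toℕ; fromℕ; fromℕ<; inject₁)
import Data.Fin.Properties as Fin
open import Data.Integer.Base using (ℤ; +_; 1ℤ; _⊖_) renaming (_-_ to _ℤ-_; _+_ to _ℤ+_; _*_ to _ℤ*_)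
import Data.Integer.Properties as ℤ
import Data.Integer.Tactic.RingSolver as ℤSolver
open import Data.Nat.Base
  using (ℕ; zero; suc; _+_; _*_; _∸_; _⊓_; ∣_-_∣; _/_; _%_; _≤_; _<_; z≤n; s≤s)
open import Data.Nat.Divisibility using (_∣_; m%n≡0⇒n∣m)
open import Data.Nat.DivMod using (m≡m%n+[m/n]*n; m%n<n)
open import Data.Nat.Properties renaming (_≟_ to _ℕ≟_)
open import Data.Nat.Tactic.RingSolver using (solve-∀)
open import Data.Product.Base using (∃; _×_; _,_; proj₁; proj₂)
open import Data.Sum.Base using (inj₁; inj₂)
open import Data.Vec.Base using (Vec; []; _∷_; map; replicate; zipWith)
open import Data.Vec.Properties using (∷-injective)
open import Data.Vec.Relation.Unary.All using (All; []; _∷_)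
open import Data.Vec.Relation.Unary.Unique.Propositional using ([]; _∷_)
open import Relation.Binary.Construct.Closure.ReflexiveTransitive using (Star; ε; _◅_)
open import Relation.Binary.Definitions using (tri<; tri≈; tri>)
open import Relation.Binary.PropositionalEquality
  using (_≡_; _≢_; refl; sym; trans; cong; cong₂; subst; subst₂; module ≡-Reasoning)
open import Relation.Nullary.Decidable using (yes; no)
open import Relation.Nullary.Negation using (¬_; contradiction)

-- Passing between integer differences and sums of naturals.

m-n≡o-p⇒m+p≡o+n : ∀ m n o p → + m ℤ- + n ≡ + o ℤ- + p → m + p ≡ o + n
m-n≡o-p⇒m+p≡o+n m n o p eq = ℤ.+-injective (begin
  + m ℤ+ + p                      ≡⟨ shift (+ m) (+ n) (+ p) ⟩
  (+ m ℤ- + n) ℤ+ (+ n ℤ+ + p)    ≡⟨ cong (_ℤ+ (+ n ℤ+ + p)) eq ⟩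
  (+ o ℤ- + p) ℤ+ (+ n ℤ+ + p)    ≡⟨ unshift (+ o) (+ n) (+ p) ⟩
  + o ℤ+ + n                      ∎)
  where
  open ≡-Reasoning
  shift : ∀ a b c → a ℤ+ c ≡ (a ℤ- b) ℤ+ (b ℤ+ c)
  shift = ℤSolver.solve-∀
  unshift : ∀ a b c → (a ℤ- c) ℤ+ (b ℤ+ c) ≡ a ℤ+ b
  unshift = ℤSolver.solve-∀

m+p≡o+n⇒m-n≡o-p : ∀ m n o p → m + p ≡ o + n → + m ℤ- + n ≡ + o ℤ- + p
m+p≡o+n⇒m-n≡o-p m n o p eq = begin
  + m ℤ- + n           ≡⟨ ℤ.m-n≡m⊖n m n ⟩
  m ⊖ n                ≡⟨ ℤ.+-cancelˡ-⊖ p m n ⟨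
  (p + m) ⊖ (p + n)    ≡⟨ cong₂ _⊖_ (trans (+-comm p m) (trans eq (+-comm o n))) (+-comm p n) ⟩
  (n + o) ⊖ (n + p)    ≡⟨ ℤ.+-cancelˡ-⊖ n o p ⟩
  o ⊖ p                ≡⟨ ℤ.m-n≡m⊖n o p ⟨
  + o ℤ- + p           ∎
  where open ≡-Reasoning

-- Injectivity of f - g, without subtraction.
InjectiveDifference : {A : Set} (f g : A → ℕ) → Set
InjectiveDifference f g = ∀ x y → f x + g y ≡ f y + g x → x ≡ y

-- Doubly resolving sets coordinatewise, and a characterisation of distance.

module _ (G : Graph) where
  open Graph G

  SameDifference : V → V → ℤ → V → Set
  SameDifference x y c q = + d x q ℤ- + d y q ≡ c

  zipWith≡⇒All : ∀ {x y c l} (Q : Vec V l) →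
    zipWith _ℤ-_ (r x Q) (r y Q) ≡ map (c ℤ*_) (replicate l 1ℤ) → All (SameDifference x y c) Q
  zipWith≡⇒All []              _  = []
  zipWith≡⇒All {c = c} (q ∷ Q) eq with e , es ← ∷-injective eq =
    trans e (ℤ.*-identityʳ c) ∷ zipWith≡⇒All Q es

  All⇒zipWith≡ : ∀ {x y c l} {Q : Vec V l} → All (SameDifference x y c) Q →
    zipWith _ℤ-_ (r x Q) (r y Q) ≡ map (c ℤ*_) (replicate l 1ℤ)
  All⇒zipWith≡ []               = refl
  All⇒zipWith≡ {c = c} (e ∷ es) =
    cong₂ _∷_ (trans e (sym (ℤ.*-identityʳ c))) (All⇒zipWith≡ es)

  sameDifference⇒¬doublyResolving : ∀ {x y c l} {Q : Vec V l} → x ≢ y →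
    All (SameDifference x y c) Q → ¬ DoublyResolving Q
  sameDifference⇒¬doublyResolving {x} {y} {c} x≢y es dr = dr x y x≢y c (All⇒zipWith≡ es)

  -- Local conditions that force `f` to be the distance to `v`: `lipschitz` bounds every walk to `v`
  -- from below, `descent` builds a walk attaining the bound. Distances can thus be found without
  -- evaluating the search behind `d`.
  record IsDistanceTo (v : V) (f : V → ℕ) : Set where
    field
      zero-at   : f v ≡ 0
      lipschitz : ∀ {u w} → u ~ w → f u ≤ suc (f w)
      descent   : ∀ {u} → u ≢ v → ∃ λ w → u ~ w × suc (f w) ≡ f u

  module _ {v f} (isDist : IsDistanceTo v f) where
    open IsDistanceTo isDist

    f≤length : ∀ {u} (w : Star _~_ u v) → f u ≤ length w
    f≤length ε       = ≤-reflexive zero-at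
    f≤length (e ◅ w) = ≤-trans (lipschitz e) (s≤s (f≤length w))

    -- Following `descent` lowers `f` by one at each step, so the recursion is on the value `n` of
    -- `f`.
    walkOfLength-f : ∀ n u → f u ≡ n → WalkOfLength u v n
    walkOfLength-f n u fu≡n with u ≟ v
    walkOfLength-f n u fu≡n | yes refl = ε , trans (sym zero-at) fu≡n
    walkOfLength-f n u fu≡n | no u≢v with descent u≢v
    walkOfLength-f zero    u fu≡n | no u≢v | w , e , eq = contradiction (trans eq fu≡n) 1+n≢0
    walkOfLength-f (suc n) u fu≡n | no u≢v | w , e , eq
      with p , len ← walkOfLength-f n w (suc-injective (trans eq fu≡n)) = e ◅ p , cong suc len

    d-unique : ∀ u → d u v ≡ f u
    d-unique u with (w , len) , min ← d-isLeast u v =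
      ≤-antisym (min (f u) (walkOfLength-f (f u) u refl)) (subst (f u ≤_) len (f≤length w))

  d-refl : ∀ v → d v v ≡ 0
  d-refl v = n≤0⇒n≡0 (proj₂ (d-isLeast v v) 0 (ε , refl))

  d-lipschitz : ∀ {u w} v → u ~ w → d u v ≤ suc (d w v)
  d-lipschitz {u} {w} v e with (p , len) , _ ← d-isLeast w v =
    proj₂ (d-isLeast u v) _ (e ◅ p , cong suc len)

  -- The first edge of a shortest walk leads to `w`: the rest of that walk bounds `d w v` from
  -- above, the Lipschitz property from below.
  d-descent : ∀ {u} v → u ≢ v → ∃ λ w → u ~ w × suc (d w v) ≡ d u v
  d-descent {u} v u≢v with d-isLeast u v
  ... | (ε , _) , _ = contradiction refl u≢v
  ... | (_◅_ {_} {w} e p , len) , _ = w , e , ≤-antisym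
    (subst (suc (d w v) ≤_) len (s≤s (proj₂ (d-isLeast w v) _ (p , refl))))
    (d-lipschitz v e)

  d-isDistanceTo : ∀ v → IsDistanceTo v (λ u → d u v)
  d-isDistanceTo v = record
    { zero-at = d-refl v ; lipschitz = d-lipschitz v ; descent = d-descent v }

  d-adjacent : ∀ {u v} → u ~ v → d u v ≡ 1
  d-adjacent {u} {v} e with d u v | d-isLeast u v
  ... | zero        | (ε , _) , _ = contradiction e (~-irrefl refl)
  ... | suc zero    | _           = refl
  ... | suc (suc _) | _ , min with s≤s () ← min 1 (e ◅ ε , refl)

-- Distances and doubly resolving sets in cartesian products.

module _ (G H : Graph) where
  private
    module G = Graph G
    module H = Graph H
    module G□H = Graph (G □ H)

  -- A product edge changes only one of the two summands. Descent moves in `G` until the first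
  -- component is `a`, and only then in `H`.
  □-isDistanceTo : ∀ {a s f g} → IsDistanceTo G a f → IsDistanceTo H s g →
                   IsDistanceTo (G □ H) (a , s) (λ (x , h) → f x + g h)
  □-isDistanceTo {a} {s} {f} {g} F K = record
    { zero-at   = cong₂ _+_ F.zero-at K.zero-at
    ; lipschitz = lip
    ; descent   = desc _
    }
    where
    module F = IsDistanceTo F
    module K = IsDistanceTo K
    lip : ∀ {u w} → u G□H.~ w → f (proj₁ u) + g (proj₂ u) ≤ suc (f (proj₁ w) + g (proj₂ w))
    lip {_ , h}         (inj₁ (refl , e)) = +-monoˡ-≤ (g h) (F.lipschitz e)
    lip {x , h} {_ , i} (inj₂ (refl , e)) =
      subst (f x + g h ≤_) (+-suc (f x) (g i)) (+-monoʳ-≤ (f x) (K.lipschitz e))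
    desc : ∀ u → u ≢ (a , s) →
           ∃ λ w → u G□H.~ w × suc (f (proj₁ w) + g (proj₂ w)) ≡ f (proj₁ u) + g (proj₂ u)
    desc (x , h) u≢ with x G.≟ a
    ... | no x≢a with y , e , eq ← F.descent x≢a =
      (y , h) , inj₁ (refl , e) , cong (_+ g h) eq
    ... | yes refl with i , e , eq ← K.descent (λ { refl → u≢ refl }) =
      (x , i) , inj₂ (refl , e) , trans (sym (+-suc (f x) (g i))) (cong (_+_ (f x)) eq)

  d-□ : ∀ x h a s → G□H.d (x , h) (a , s) ≡ G.d x a + H.d h s
  d-□ x h a s = d-unique (G □ H)
    (□-isDistanceTo (d-isDistanceTo G a) (d-isDistanceTo H s)) (x , h)

  □-pairNotResolving : ∀ {g g′ h h′} → g ≢ g′ → h ≢ h′ → ∀ p q →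
    ¬ InjectiveDifference (λ x → G□H.d x p) (λ x → G□H.d x q)
  □-pairNotResolving {g} {g′} {h} {h′} g≢g′ h≢h′ (a , s) (b , t) inj with a G.≟ b | s H.≟ t
  -- The distance to `a` enters both coordinates equally and cancels in their difference, so the
  -- component in `G` stays undetermined.
  ... | yes refl | _ = contradiction (cong proj₁ (inj (g , h) (g′ , h) eq)) g≢g′
    where
    rearrange : ∀ α β γ δ → (α + β) + (γ + δ) ≡ (γ + β) + (α + δ)
    rearrange = solve-∀
    eq : G□H.d (g , h) (a , s) + G□H.d (g′ , h) (a , t)
       ≡ G□H.d (g′ , h) (a , s) + G□H.d (g , h) (a , t)
    eq rewrite d-□ g h a s | d-□ g′ h a t | d-□ g′ h a s | d-□ g h a t =
      rearrange (G.d g a) (H.d h s) (G.d g′ a) (H.d h t)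
  ... | no _ | yes refl = contradiction (cong proj₂ (inj (g , h) (g , h′) eq)) h≢h′
    where
    rearrange : ∀ α β γ δ → (α + β) + (γ + δ) ≡ (α + δ) + (γ + β)
    rearrange = solve-∀
    eq : G□H.d (g , h) (a , s) + G□H.d (g , h′) (b , s)
       ≡ G□H.d (g , h′) (a , s) + G□H.d (g , h) (b , s)
    eq rewrite d-□ g h a s | d-□ g h′ b s | d-□ g h′ a s | d-□ g h b s =
      rearrange (G.d g a) (H.d h s) (G.d g b) (H.d h′ s)
  ... | no a≢b | no s≢t
    with a′ , a~a′ , closerᴳ ← d-descent G b a≢b
       | s′ , s~s′ , closerᴴ ← d-descent H t s≢t =
    -- Both `(a′ , s)` and `(a , s′)` are at distance 1 from `(a , s)` and one step closer than it
    -- to `(b , t)`. Identifying them would make `a` adjacent to itself.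
    contradiction (subst (a G.~_) (cong proj₁ (inj (a′ , s) (a , s′) eq)) a~a′) (G.~-irrefl refl)
    where
    rearrange : ∀ β δ → (1 + 0) + (suc β + δ) ≡ (0 + 1) + (β + suc δ)
    rearrange = solve-∀
    eq : G□H.d (a′ , s) (a , s) + G□H.d (a , s′) (b , t)
       ≡ G□H.d (a , s′) (a , s) + G□H.d (a′ , s) (b , t)
    eq rewrite d-□ a′ s a s | d-□ a s′ b t | d-□ a s′ a s | d-□ a′ s b t
             | d-adjacent G (G.~-sym a~a′) | d-adjacent H (H.~-sym s~s′)
             | d-refl G a | d-refl H s | sym closerᴳ | sym closerᴴ =
      rearrange (G.d a′ b) (H.d s′ t)

  □-doublyResolving⇒3≤l : ∀ {g g′ h h′} → g ≢ g′ → h ≢ h′ → ∀ {l} (Q : Vec G□H.V l) →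
                    G□H.DoublyResolving Q → 3 ≤ l
  -- Without coordinates any constant will do; `+ 0` is an arbitrary choice.
  □-doublyResolving⇒3≤l {g} {g′} {h} g≢g′ h≢h′ [] dr = contradiction dr
    (sameDifference⇒¬doublyResolving (G □ H) {g , h} {g′ , h} {+ 0}
      (λ eq → g≢g′ (cong proj₁ eq)) [])
  □-doublyResolving⇒3≤l {g} {g′} {h} g≢g′ h≢h′ (p ∷ []) dr = contradiction dr
    (sameDifference⇒¬doublyResolving (G □ H) {g , h} {g′ , h}
      (λ eq → g≢g′ (cong proj₁ eq)) (refl ∷ []))
  □-doublyResolving⇒3≤l g≢g′ h≢h′ (p ∷ q ∷ []) dr =
    contradiction inj (□-pairNotResolving g≢g′ h≢h′ p q)
    where
    inj : InjectiveDifference (λ x → G□H.d x p) (λ x → G□H.d x q)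
    -- `DoublyResolving` concerns distinct vertices only, hence the case split. For these, the
    -- constant is the difference of distances to `q`.
    inj x y eq with x G□H.≟ y
    ... | yes x≡y = x≡y
    ... | no x≢y  = contradiction dr (sameDifference⇒¬doublyResolving (G □ H) x≢y
      (m+p≡o+n⇒m-n≡o-p (G□H.d x p) (G□H.d y p) (G□H.d x q) (G□H.d y q)
        (trans eq (+-comm (G□H.d y p) (G□H.d x q))) ∷ refl ∷ []))
  □-doublyResolving⇒3≤l _ _ (_ ∷ _ ∷ _ ∷ _) _ = s≤s (s≤s (s≤s z≤n))

  □-doublyResolving : ∀ {a b s t} →
    InjectiveDifference (λ x → G.d x a) (λ x → G.d x b) →
    InjectiveDifference (λ h → H.d h s) (λ h → H.d h t) →
    G□H.DoublyResolving ((a , s) ∷ (b , s) ∷ (a , t) ∷ [])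
  □-doublyResolving {a} {b} {s} {t} injᴳ injᴴ (x , h) (y , i) x≢y c eq
    with e₁ ∷ e₂ ∷ e₃ ∷ [] ← zipWith≡⇒All (G □ H) {c = c} ((a , s) ∷ (b , s) ∷ (a , t) ∷ []) eq =
    x≢y (cong₂ _,_ x≡y h≡i)
    where
    open ≡-Reasoning
    -- Comparing two coordinates eliminates `c`.
    balance : ∀ {p q} → SameDifference (G □ H) (x , h) (y , i) c p →
              SameDifference (G □ H) (x , h) (y , i) c q →
              G□H.d (x , h) p + G□H.d (y , i) q ≡ G□H.d (y , i) p + G□H.d (x , h) q
    balance {p} {q} ep eq = trans
      (m-n≡o-p⇒m+p≡o+n (G□H.d (x , h) p) _ (G□H.d (x , h) q) _ (trans ep (sym eq)))
      (+-comm (G□H.d (x , h) q) _)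
    swapᴳ : ∀ α β γ δ → (γ + δ) + (α + β) ≡ (α + γ) + (β + δ)
    swapᴳ = solve-∀
    -- The landmarks `(a , s)` and `(b , s)` share `s`, so the distances in `H` cancel.
    x≡y : x ≡ y
    x≡y = injᴳ x y (+-cancelˡ-≡ (H.d h s + H.d i s) _ _ (begin
      H.d h s + H.d i s + (G.d x a + G.d y b)
        ≡⟨ swapᴳ (G.d x a) (G.d y b) _ _ ⟩
      G.d x a + H.d h s + (G.d y b + H.d i s)
        ≡⟨ cong₂ _+_ (d-□ x h a s) (d-□ y i b s) ⟨
      G□H.d (x , h) (a , s) + G□H.d (y , i) (b , s)
        ≡⟨ balance e₁ e₂ ⟩
      G□H.d (y , i) (a , s) + G□H.d (x , h) (b , s)
        ≡⟨ cong₂ _+_ (d-□ y i a s) (d-□ x h b s) ⟩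
      G.d y a + H.d i s + (G.d x b + H.d h s)
        ≡⟨ swapᴳ (G.d y a) (G.d x b) _ _ ⟨
      H.d i s + H.d h s + (G.d y a + G.d x b)
        ≡⟨ cong (_+ (G.d y a + G.d x b)) (+-comm (H.d i s) _) ⟩
      H.d h s + H.d i s + (G.d y a + G.d x b) ∎))
    swapᴴ : ∀ α β γ δ → (α + β) + (γ + δ) ≡ (α + γ) + (β + δ)
    swapᴴ = solve-∀
    -- The landmarks `(a , s)` and `(a , t)` share `a`, so the distances in `G` cancel.
    h≡i : h ≡ i
    h≡i = injᴴ h i (+-cancelˡ-≡ (G.d x a + G.d y a) _ _ (begin
      G.d x a + G.d y a + (H.d h s + H.d i t)
        ≡⟨ swapᴴ (G.d x a) _ _ _ ⟩
      G.d x a + H.d h s + (G.d y a + H.d i t)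
        ≡⟨ cong₂ _+_ (d-□ x h a s) (d-□ y i a t) ⟨
      G□H.d (x , h) (a , s) + G□H.d (y , i) (a , t)
        ≡⟨ balance e₁ e₃ ⟩
      G□H.d (y , i) (a , s) + G□H.d (x , h) (a , t)
        ≡⟨ cong₂ _+_ (d-□ y i a s) (d-□ x h a t) ⟩
      G.d y a + H.d i s + (G.d x a + H.d h t)
        ≡⟨ swapᴴ (G.d y a) _ _ _ ⟨
      G.d y a + G.d x a + (H.d i s + H.d h t)
        ≡⟨ cong (_+ (H.d i s + H.d h t)) (+-comm (G.d y a) _) ⟩
      G.d x a + G.d y a + (H.d i s + H.d h t) ∎))

-- Distances in paths and cycles.

∣m-n∣≤1+∣1+m-n∣ : ∀ m n → ∣ m - n ∣ ≤ suc ∣ suc m - n ∣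
∣m-n∣≤1+∣1+m-n∣ zero    zero    = z≤n
∣m-n∣≤1+∣1+m-n∣ zero    (suc n) = ≤-refl
∣m-n∣≤1+∣1+m-n∣ (suc m) zero    = ≤-trans (n≤1+n _) (n≤1+n _)
∣m-n∣≤1+∣1+m-n∣ (suc m) (suc n) = ∣m-n∣≤1+∣1+m-n∣ m n

∣1+m-n∣≤1+∣m-n∣ : ∀ m n → ∣ suc m - n ∣ ≤ suc ∣ m - n ∣
∣1+m-n∣≤1+∣m-n∣ zero    zero    = ≤-refl
∣1+m-n∣≤1+∣m-n∣ zero    (suc n) = ≤-trans (n≤1+n _) (n≤1+n _)
∣1+m-n∣≤1+∣m-n∣ (suc m) zero    = ≤-refl
∣1+m-n∣≤1+∣m-n∣ (suc m) (suc n) = ∣1+m-n∣≤1+∣m-n∣ m n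

m<n⇒1+∣1+m-n∣≡∣m-n∣ : ∀ {m n} → m < n → suc ∣ suc m - n ∣ ≡ ∣ m - n ∣
m<n⇒1+∣1+m-n∣≡∣m-n∣ {zero}  {suc n} _         = refl
m<n⇒1+∣1+m-n∣≡∣m-n∣ {suc m} {suc n} (s≤s m<n) = m<n⇒1+∣1+m-n∣≡∣m-n∣ m<n

n≤m⇒1+∣m-n∣≡∣1+m-n∣ : ∀ {m n} → n ≤ m → suc ∣ m - n ∣ ≡ ∣ suc m - n ∣
n≤m⇒1+∣m-n∣≡∣1+m-n∣ {m}     {zero}  _         = cong suc (∣-∣-identityʳ m)
n≤m⇒1+∣m-n∣≡∣1+m-n∣ {suc m} {suc n} (s≤s n≤m) = n≤m⇒1+∣m-n∣≡∣1+m-n∣ n≤m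

pathAdj-lipschitz : ∀ {n} (v : Fin n) {i j : Fin n} → PathAdj i j →
                    ∣ toℕ i - toℕ v ∣ ≤ suc ∣ toℕ j - toℕ v ∣
pathAdj-lipschitz v {i} {j} (inj₁ s) =
  subst (λ x → ∣ toℕ i - toℕ v ∣ ≤ suc ∣ x - toℕ v ∣) s (∣m-n∣≤1+∣1+m-n∣ (toℕ i) (toℕ v))
pathAdj-lipschitz v {i} {j} (inj₂ s) =
  subst (λ x → ∣ x - toℕ v ∣ ≤ suc ∣ toℕ j - toℕ v ∣) s (∣1+m-n∣≤1+∣m-n∣ (toℕ j) (toℕ v))

pathAdj-descent : ∀ {n} (v : Fin n) {i} → i ≢ v →
                  ∃ λ j → PathAdj i j × suc ∣ toℕ j - toℕ v ∣ ≡ ∣ toℕ i - toℕ v ∣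
pathAdj-descent v {i} i≢v with <-cmp (toℕ i) (toℕ v)
... | tri≈ _ i≡v _ = contradiction (Fin.toℕ-injective i≡v) i≢v
... | tri< i<v _ _ = fromℕ< 1+i<n , inj₁ (sym toℕ-j)
    , trans (cong (λ x → suc ∣ x - toℕ v ∣) toℕ-j) (m<n⇒1+∣1+m-n∣≡∣m-n∣ i<v)
  where
  1+i<n = ≤-<-trans i<v (Fin.toℕ<n v)
  toℕ-j = Fin.toℕ-fromℕ< 1+i<n
pathAdj-descent v {suc i} i≢v | tri> _ _ (s≤s v≤i) = inject₁ i , inj₂ (cong suc (Fin.toℕ-inject₁ i))
    , trans (cong (λ x → suc ∣ x - toℕ v ∣) (Fin.toℕ-inject₁ i)) (n≤m⇒1+∣m-n∣≡∣1+m-n∣ v≤i)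

path-isDistanceTo : ∀ {k} (v : Fin k) → IsDistanceTo (P k) v (λ i → ∣ toℕ i - toℕ v ∣)
path-isDistanceTo v = record
  { zero-at   = ∣n-n∣≡0 (toℕ v)
  ; lipschitz = pathAdj-lipschitz v
  ; descent   = pathAdj-descent v
  }

1+m∸n≤1+[m∸n] : ∀ m n → suc m ∸ n ≤ suc (m ∸ n)
1+m∸n≤1+[m∸n] m       zero    = ≤-refl
1+m∸n≤1+[m∸n] zero    (suc n) = ≤-trans (m∸n≤m 0 n) z≤n
1+m∸n≤1+[m∸n] (suc m) (suc n) = 1+m∸n≤1+[m∸n] m n

-- The two arcs from `i` to `zero` have lengths `toℕ i` and `suc n ∸ toℕ i`; descent follows a
-- shorter one.
cycle-isDistanceTo-zero : ∀ {n} (3≤n : 3 ≤ suc n) →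
  IsDistanceTo (C (suc n) 3≤n) zero (λ i → toℕ i ⊓ (suc n ∸ toℕ i))
cycle-isDistanceTo-zero {n} 3≤n = record
  { zero-at   = refl
  ; lipschitz = lip
  ; descent   = desc
  }
  where
  f : ℕ → ℕ
  f i = i ⊓ (suc n ∸ i)
  f[n]≤1 : f n ≤ 1
  f[n]≤1 = ≤-trans (m⊓n≤n n _) (≤-reflexive (m+n∸n≡m 1 n))
  lip : ∀ {i j} → CycleAdj i j → f (toℕ i) ≤ suc (f (toℕ j))
  lip {i} {j} (inj₁ (inj₁ s)) = subst (λ x → f (toℕ i) ≤ suc (f x)) s
    (⊓-mono-≤ (≤-trans (n≤1+n _) (n≤1+n _)) (1+m∸n≤1+[m∸n] n (toℕ i)))
  lip {i} {j} (inj₂ (inj₁ s)) = subst (λ x → f x ≤ suc (f (toℕ j))) s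
    (⊓-mono-≤ ≤-refl (≤-trans (∸-monoˡ-≤ (toℕ j) (n≤1+n n)) (n≤1+n _)))
  lip (inj₁ (inj₂ (1+i≡n , j≡0))) rewrite suc-injective 1+i≡n | j≡0 = f[n]≤1
  lip {i} (inj₂ (inj₂ (_ , i≡0))) rewrite i≡0 = z≤n
  desc : ∀ {i : Fin (suc n)} → i ≢ zero → ∃ λ j → CycleAdj i j × suc (f (toℕ j)) ≡ f (toℕ i)
  desc {zero}  i≢0 = contradiction refl i≢0
  desc {i@(suc i′)} _ with ≤-total (toℕ i) (suc n ∸ toℕ i)
  ... | inj₁ i≤n∸i = inject₁ i′ , inj₂ (inj₁ (cong suc (Fin.toℕ-inject₁ i′))) , (begin
    suc (f (toℕ (inject₁ i′))) ≡⟨ cong (λ x → suc (f x)) (Fin.toℕ-inject₁ i′) ⟩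
    suc (f (toℕ i′))           ≡⟨ cong suc (m≤n⇒m⊓n≡m (≤-trans (n≤1+n _)
                                    (≤-trans i≤n∸i (∸-monoˡ-≤ (toℕ i′) (n≤1+n n))))) ⟩
    toℕ i                      ≡⟨ m≤n⇒m⊓n≡m i≤n∸i ⟨
    f (toℕ i)                  ∎)
    where open ≡-Reasoning
  ... | inj₂ n∸i≤i with toℕ i ℕ≟ n
  -- The upward arc is chosen here. Its next vertex is the successor, except that the last vertex
  -- `n` wraps around to `zero`.
  ...   | yes i≡n = zero , inj₁ (inj₂ (cong suc i≡n , refl)) , (begin
    1              ≡⟨ m+n∸n≡m 1 n ⟨
    suc n ∸ n      ≡⟨ cong (suc n ∸_) i≡n ⟨
    suc n ∸ toℕ i  ≡⟨ m≥n⇒m⊓n≡n n∸i≤i ⟨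
    f (toℕ i)      ∎)
    where open ≡-Reasoning
  ...   | no i≢n = fromℕ< 1+i<1+n , inj₁ (inj₁ (sym toℕ-j)) , (begin
    suc (f (toℕ (fromℕ< 1+i<1+n)))  ≡⟨ cong (λ x → suc (f x)) toℕ-j ⟩
    suc (f (suc (toℕ i)))           ≡⟨ cong suc (m≥n⇒m⊓n≡n (≤-trans (∸-monoˡ-≤ (toℕ i) (n≤1+n n))
                                         (≤-trans n∸i≤i (n≤1+n _)))) ⟩
    suc (n ∸ toℕ i)                 ≡⟨ +-∸-assoc 1 (<⇒≤ i<n) ⟨
    suc n ∸ toℕ i                   ≡⟨ m≥n⇒m⊓n≡n n∸i≤i ⟨
    f (toℕ i)                       ∎)
    where
    open ≡-Reasoning
    i<n = ≤∧≢⇒< (Fin.toℕ≤pred[n] i) i≢n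
    1+i<1+n = s≤s i<n
    toℕ-j = Fin.toℕ-fromℕ< 1+i<1+n

-- The edge joining the two ends of the cycle does not shorten distances to the
-- middle vertex m, so these are the same as in the path.
cycle-isDistanceTo-middle : ∀ {m} (3≤n : 3 ≤ suc (m + m)) (v : Fin (suc (m + m))) → toℕ v ≡ m →
  IsDistanceTo (C (suc (m + m)) 3≤n) v (λ i → ∣ toℕ i - toℕ v ∣)
cycle-isDistanceTo-middle {m} 3≤n v v≡m = record
  { zero-at   = ∣n-n∣≡0 (toℕ v)
  ; lipschitz = lip
  ; descent   = desc
  }
  where
  f : Fin (suc (m + m)) → ℕ
  f i = ∣ toℕ i - toℕ v ∣
  -- The ends 0 and 2m both lie at distance m from the middle, so `f` is constant along the closing
  -- edge.
  antipodal : ∀ {i j : Fin (suc (m + m))} → suc (toℕ i) ≡ suc (m + m) → toℕ j ≡ 0 → f i ≡ f j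
  antipodal 1+i≡n j≡0 rewrite suc-injective 1+i≡n | j≡0 | v≡m =
    trans (∣-∣-comm (m + m) m) (∣m-m+n∣≡n m m)
  lip : ∀ {i j} → CycleAdj i j → f i ≤ suc (f j)
  lip (inj₁ (inj₁ s)) = pathAdj-lipschitz v (inj₁ s)
  lip (inj₂ (inj₁ s)) = pathAdj-lipschitz v (inj₂ s)
  lip {i} (inj₁ (inj₂ (e , z))) = ≤-trans (≤-reflexive (antipodal {i} e z)) (n≤1+n _)
  lip {_} {j} (inj₂ (inj₂ (e , z))) = ≤-trans (≤-reflexive (sym (antipodal {j} e z))) (n≤1+n _)
  desc : ∀ {i} → i ≢ v → ∃ λ j → CycleAdj i j × suc (f j) ≡ f i
  desc i≢v with pathAdj-descent v i≢v
  ... | j , inj₁ s , eq = j , inj₁ (inj₁ s) , eq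
  ... | j , inj₂ s , eq = j , inj₂ (inj₁ s) , eq

-- Landmark pairs with injective difference in paths and odd cycles.

p+q≡p′+q′∧p+q′≡p′+q⇒p≡p′ : ∀ p q p′ q′ → p + q ≡ p′ + q′ → p + q′ ≡ p′ + q → p ≡ p′
p+q≡p′+q′∧p+q′≡p′+q⇒p≡p′ p q p′ q′ e₁ e₂ =
  -- Adding the two hypotheses lets `q + q′` cancel and leaves `2 * p ≡ 2 * p′`.
  *-cancelˡ-≡ p p′ 2 (+-cancelʳ-≡ (q + q′) _ _ (begin
    2 * p + (q + q′)         ≡⟨ left p q q′ ⟩
    (p + q) + (p + q′)       ≡⟨ cong₂ _+_ e₁ e₂ ⟩
    (p′ + q′) + (p′ + q)     ≡⟨ right p′ q q′ ⟩
    2 * p′ + (q + q′)        ∎))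
  where
  open ≡-Reasoning
  left : ∀ a b c → 2 * a + (b + c) ≡ (a + b) + (a + c)
  left = solve-∀
  right : ∀ a b c → (a + c) + (a + b) ≡ 2 * a + (b + c)
  right = solve-∀

-- The parity obstruction that separates the two arcs of the cycle: adding the equations would make
-- an even number equal to an odd one.
p+q≡p′+q′⇒p+q′≢1+p′+q : ∀ p q p′ q′ → p + q ≡ p′ + q′ → p + q′ ≢ suc (p′ + q)
p+q≡p′+q′⇒p+q′≢1+p′+q p q p′ q′ e₁ e₂ =
  even≢odd p p′ (+-cancelʳ-≡ (q + q′) _ _ (begin
    2 * p + (q + q′)            ≡⟨ left p q q′ ⟩
    (p + q) + (p + q′)          ≡⟨ cong₂ _+_ e₁ e₂ ⟩
    (p′ + q′) + suc (p′ + q)    ≡⟨ right p′ q q′ ⟩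
    suc (2 * p′) + (q + q′)     ∎))
  where
  open ≡-Reasoning
  left : ∀ a b c → 2 * a + (b + c) ≡ (a + b) + (a + c)
  left = solve-∀
  right : ∀ a b c → (a + c) + suc (a + b) ≡ suc (2 * a) + (b + c)
  right = solve-∀

i≤j⇒i+∣i-j∣≡j : ∀ {i j} → i ≤ j → i + ∣ i - j ∣ ≡ j
i≤j⇒i+∣i-j∣≡j {i} i≤j = trans (cong (_+_ i) (m≤n⇒∣m-n∣≡n∸m i≤j)) (m+[n∸m]≡n i≤j)

-- The distances to the two ends sum to `k`, so equal differences force equal positions.
path-injectiveDifference : ∀ k → let open Graph (P (suc k)) in
  InjectiveDifference (λ i → d i zero) (λ i → d i (fromℕ k))
path-injectiveDifference k i j eq = Fin.toℕ-injective (p+q≡p′+q′∧p+q′≡p′+q⇒p≡p′ (toℕ i) _ (toℕ j) _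
  (trans (split i) (sym (split j)))
  (subst₂ _≡_ (cong₂ _+_ (d-zero i) (d-last j)) (cong₂ _+_ (d-zero j) (d-last i)) eq))
  where
  open Graph (P (suc k))
  d-zero : ∀ i → d i zero ≡ toℕ i
  d-zero i = trans (d-unique (P (suc k)) (path-isDistanceTo zero) i) (∣-∣-identityʳ (toℕ i))
  d-last : ∀ i → d i (fromℕ k) ≡ ∣ toℕ i - k ∣
  d-last i = trans (d-unique (P (suc k)) (path-isDistanceTo (fromℕ k)) i)
                   (cong (λ x → ∣ toℕ i - x ∣) (Fin.toℕ-fromℕ k))
  split : ∀ i → toℕ i + ∣ toℕ i - k ∣ ≡ k
  split i = i≤j⇒i+∣i-j∣≡j (Fin.toℕ≤pred[n] i)

-- The position i of a vertex of C_(2m+1), with its distances e to 0 and q to m.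
data Arc (m : ℕ) : (i e q : ℕ) → Set where
  first  : ∀ p {q} → p + q ≡ m → Arc m p p q
  second : ∀ p {q} → p + q ≡ m → Arc m (m + q) (suc p) q

arc : ∀ m i → i ≤ m + m → Arc m i (i ⊓ (suc (m + m) ∸ i)) ∣ i - m ∣
arc m i i≤2m with ≤-<-connex i m
... | inj₁ i≤m = subst (λ e → Arc m i e ∣ i - m ∣)
  (sym (m≤n⇒m⊓n≡m (≤-trans i≤m (m+n≤o⇒m≤o∸n m (≤-trans (+-monoʳ-≤ m i≤m) (n≤1+n _))))))
  (first i (i≤j⇒i+∣i-j∣≡j i≤m))
-- Writing `i = m + q` and then `m = q + p` turns the position into `q + p + q`, which rids the
-- claim of truncated subtraction.
... | inj₂ m<i with q , refl ← m≤n⇒∃[o]m+o≡n (<⇒≤ m<i)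
               with p , refl ← m≤n⇒∃[o]m+o≡n (+-cancelˡ-≤ m q m i≤2m) =
  subst₂ (Arc m _) (sym e≡1+p) (sym q≡) (second p (+-comm p q))
  where
  open ≡-Reasoning
  q≡ : ∣ q + p + q - (q + p) ∣ ≡ q
  q≡ = trans (∣-∣-comm (q + p + q) (q + p)) (∣m-m+n∣≡n (q + p) q)
  rest : suc (q + p + (q + p)) ∸ (q + p + q) ≡ suc p
  rest = trans (cong (_∸ (q + p + q)) (rearrange q p)) (m+n∸m≡n (q + p + q) (suc p))
    where
    rearrange : ∀ q p → suc (q + p + (q + p)) ≡ (q + p + q) + suc p
    rearrange = solve-∀
  -- Beyond the middle, the arc through the closing edge is the shorter way to 0.
  1+p≤ : suc p ≤ q + p + q
  1+p≤ = ≤-trans (s≤s (m≤n+m p q)) m<i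
  e≡1+p : (q + p + q) ⊓ (suc (q + p + (q + p)) ∸ (q + p + q)) ≡ suc p
  e≡1+p = trans (cong (_⊓_ (q + p + q)) rest) (m≥n⇒m⊓n≡n 1+p≤)

-- On the first arc `e + q` is `m`, on the second `suc m`. Within one arc the sum is fixed, so the
-- difference determines the position; across arcs parity rules out equal differences.
arc-unique : ∀ {m i i′ e e′ q q′} → Arc m i e q → Arc m i′ e′ q′ → e + q′ ≡ e′ + q → i ≡ i′
arc-unique (first p {q} s) (first p′ {q′} s′) eq =
  p+q≡p′+q′∧p+q′≡p′+q⇒p≡p′ p q p′ q′ (trans s (sym s′)) eq
arc-unique (first p {q} s) (second p′ {q′} s′) eq =
  contradiction eq (p+q≡p′+q′⇒p+q′≢1+p′+q p q p′ q′ (trans s (sym s′)))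
arc-unique (second p {q} s) (first p′ {q′} s′) eq =
  contradiction (sym eq) (p+q≡p′+q′⇒p+q′≢1+p′+q p′ q′ p q (trans s′ (sym s)))
arc-unique {m} (second p {q} s) (second p′ {q′} s′) eq
  with refl ← p+q≡p′+q′∧p+q′≡p′+q⇒p≡p′ p q p′ q′ (trans s (sym s′)) (suc-injective eq) =
  cong (_+_ m) (+-cancelˡ-≡ p q q′ (trans s (sym s′)))

middle : ∀ m → Fin (suc (m + m))
middle m = fromℕ< (s≤s (m≤m+n m m))

toℕ-middle : ∀ m → toℕ (middle m) ≡ m
toℕ-middle m = Fin.toℕ-fromℕ< (s≤s (m≤m+n m m))

cycle-injectiveDifference : ∀ m (3≤n : 3 ≤ suc (m + m)) → let open Graph (C (suc (m + m)) 3≤n) in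
  InjectiveDifference (λ i → d i zero) (λ i → d i (middle m))
cycle-injectiveDifference m 3≤n i j eq = Fin.toℕ-injective (arc-unique (arcOf i) (arcOf j) eq)
  where
  Cₙ = C (suc (m + m)) 3≤n
  open Graph Cₙ
  d-middle : ∀ i → d i (middle m) ≡ ∣ toℕ i - m ∣
  d-middle i = trans (d-unique Cₙ (cycle-isDistanceTo-middle 3≤n (middle m) (toℕ-middle m)) i)
                     (cong (λ x → ∣ toℕ i - x ∣) (toℕ-middle m))
  arcOf : ∀ i → Arc m (toℕ i) (d i zero) (d i (middle m))
  arcOf i = subst₂ (Arc m (toℕ i))
    (sym (d-unique Cₙ (cycle-isDistanceTo-zero 3≤n) i)) (sym (d-middle i))
    (arc m (toℕ i) (Fin.toℕ≤pred[n] i))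

-- Odd cycle lengths, and the value 3.

odd⇒1+m+m : ∀ n → ¬ (2 ∣ n) → ∃ λ m → n ≡ suc (m + m)
odd⇒1+m+m n 2∤n with n % 2 in n%2 | m%n<n n 2 | m≡m%n+[m/n]*n n 2
... | 0           | _              | _  = contradiction (m%n≡0⇒n∣m n 2 n%2) 2∤n
... | 1           | _              | eq = n / 2 , trans eq (cong suc (double (n / 2)))
  where
  double : ∀ m → m * 2 ≡ m + m
  double = solve-∀
... | suc (suc _) | s≤s (s≤s ())   | _

theorem3p1 : (n k : ℕ) (3≤n : 3 ≤ n) → ¬ (2 ∣ n) → 3 ≤ k → ψ[ C n 3≤n □ P k ]≡ 3
theorem3p1 n k 3≤n 2∤n 3≤k with odd⇒1+m+m n 2∤n
-- Exposing the successors in `m` and `k` makes the three landmarks distinct by constructor clash,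
-- and gives each factor the distinct vertices `zero` and `suc zero` for the lower bound.
theorem3p1 n (suc (suc k)) 3≤n@(s≤s (s≤s _)) 2∤n 3≤k | suc m , refl =
  ( (zero , zero) ∷ (middle (suc m) , zero) ∷ (zero , fromℕ (suc k)) ∷ []
  , ((λ ()) ∷ (λ ()) ∷ []) ∷ ((λ ()) ∷ []) ∷ [] ∷ []
  , □-doublyResolving (C n 3≤n) (P (suc (suc k)))
      (cycle-injectiveDifference (suc m) 3≤n) (path-injectiveDifference (suc k))
  )
  , λ l (Q , _ , dr) → □-doublyResolving⇒3≤l (C n 3≤n) (P (suc (suc k)))
      {zero} {suc zero} {zero} {suc zero} (λ ()) (λ ()) Q dr
theorem3p1 n (suc zero) _ _ (s≤s ()) | _
theorem3p1 n k (s≤s ()) _ _ | zero , refl
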